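{- A (not necessarily finite) poset $L$ is a well separated $\kappa$-lattice if and only if it is isomorphic to $\operatorname{Pairs}(\to)$ for a two-acyclic factorization system $(S,\to,\twoheadrightarrow,\hookrightarrow)$. If so, $(S,\to,\twoheadrightarrow,\hookrightarrow)$ is isomorphic to $(\operatorname{Ji}^cL,\to_L,\twoheadrightarrow_L,\hookrightarrow_L)$ (there is a bijection of underlying sets carrying each relation to the corresponding relation), and the map $$x\mapsto\bigl(\{j\in\operatorname{Ji}^cL: j\le x\},\ \kappa^d(\{m\in\operatorname{Mi}^cL: m\ge x\})\bigr)$$ is an isomorphism from $L$ to $\operatorname{Pairs}(\to_L)$, with inverse $(X,Y)\mapsto\bigvee X=\bigwedge\kappa(Y)$.
   Context: Lattices: A complete lattice is a poset in which every subset has a meet and a join. An element $j$ of a complete lattice $L$ is completely join-irreducible if $j=\bigvee X$ implies $j\in X$ for all subsets $X\subseteq L$; equivalently there is an element $j_*$ such that $x<j$ iff $x\le j_*$. Dually $m$ is completely meet-irreducible if $m=\bigwedge X$ implies $m\in X$; equivalently there is $m^*$ such that $x>m$ iff $x\ge m^*$. $\operatorname{Ji}^cL$ and $\operatorname{Mi}^cL$ are the sets of completely join-irreducible and completely meet-irreducible elements. A complete lattice is bi-spatial if every element is a join of completely join-irreducible elements and also a meet of completely meet-irreducible elements. A $\kappa$-lattice is a complete, bi-spatial lattice $L$ for which there are inverse bijections $\kappa:\operatorname{Ji}^cL\to\operatorname{Mi}^cL$ and $\kappa^d:\operatorname{Mi}^cL\to\operatorname{Ji}^cL$ such that $\kappa(j)$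 is the maximum element of $\{y: j\wedge y=j_*\}$ and $\kappa^d(m)$ is the minimum element of $\{x: m\vee x=m^*\}$. A $\kappa$-lattice is well separated if whenever $z_1\not\le z_2$, there is some $j\in\operatorname{Ji}^cL$ with $z_1\ge j$ and $\kappa(j)\ge z_2$. In a $\kappa$-lattice $L$ define relations on $\operatorname{Ji}^cL$: $i\to_L j$ iff $i\not\le\kappa(j)$; $i\twoheadrightarrow_L j$ iff $i\ge j$; $i\hookrightarrow_L j$ iff $\kappa(i)\ge\kappa(j)$. Factorization systems: For a binary relation $\to$ on a set $S$ and $X\subseteq S$, put $X^\perp=\{y\in S: x\not\to y\ \forall x\in X\}$ and ${}^\perp X=\{y\in S: y\not\to x\ \forall x\in X\}$. A maximal orthogonal pair is a pair $(X,Y)$ of subsets of $S$ with $Y=X^\perp$ and $X={}^\perp Y$. $\operatorname{Pairs}(\to)$ is the set of maximal orthogonal pairs, partially ordered by containment of first components (equivalently reverse containment of second components). For a reflexive relation $\to$ on $S$, $\operatorname{Fact}(\to)=(\twoheadrightarrow,\hookrightarrow)$, where $x\twoheadrightarrow y$ iff for all $z$, $y\to z$ implies $x\to z$, and $x\hookrightarrow y$ iff for all $z$, $z\to x$ implies $z\to y$. For preorders $\twoheadrightarrow,\hookrightarrow$ on $S$, $\operatorname{Mult}(\twoheadrightarrow,\hookrightarrow)$ is the relation relating $x$ to $z$ iff there is $y\in S$ with $x\twoheadrightarrow y\hookrightarrow z$. A factorization system is a tuple $(S,\to,\twoheadrightarrow,\hookrightarrow)$ ($S$ possibly infinite) with $\to$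 a reflexive relation on $S$, $\operatorname{Fact}(\to)=(\twoheadrightarrow,\hookrightarrow)$ and $\operatorname{Mult}(\twoheadrightarrow,\hookrightarrow)=\to$. It is two-acyclic if it satisfies the order condition ($x\twoheadrightarrow y\twoheadrightarrow x$ implies $x=y$, and $x\hookrightarrow y\hookrightarrow x$ implies $x=y$) and the brick condition ($x\twoheadrightarrow y\hookrightarrow x$ implies $x=y$). -}

module Defs where

open import Data.Product using (Σ; ∃; ∃-syntax; Σ-syntax; _×_; _,_; proj₁; proj₂)
open import Function.Bundles using (Inverse)
open import Level using (Level; _⊔_; suc)
open import Relation.Binary.Bundles using (Setoid; Poset)
import Relation.Binary.Construct.On as On
open import Relation.Binary.Core using (Rel; _⇔_)
open import Relation.Binary.Definitions using (Reflexive; Antisymmetric; _Respects_; _Respects₂_)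
open import Relation.Binary.Morphism.Structures using (IsOrderIsomorphism)
import Relation.Binary.Properties.Poset as PosetProperties
open import Relation.Nullary using (¬_)
open import Relation.Unary using (Pred; _∈_; _⊆_; _≐_; _∪_)

-- Sets are setoids, and equality of elements is the setoid equality _≈_.
-- Equality of subsets is extensional (_≐_).  A predicate that does not
-- respect _≈_ has the same joins and meets as its closure under _≈_, so
-- respect for _≈_ is required only where membership is concluded
-- (in IsCompletelyJoinIrreducible and IsCompletelyMeetIrreducible).
-- Subsets are predicates at one fixed universe level; under excluded middle
-- every predicate, of any level, is equivalent to one at that level.

module _ {a b e p : Level} {A : Set a} (B : Setoid b e) where

  image : (A → Setoid.Carrier B) → Pred A p → Pred (Setoid.Carrier B) (a ⊔ e ⊔ p)
  image f X z = ∃[ x ] x ∈ X × Setoid._≈_ B z (f x)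

infix 4 _≅_

_≅_ : ∀ {a b c d e f : Level} → Poset a b c → Poset d e f → Set (a ⊔ b ⊔ c ⊔ d ⊔ e ⊔ f)
P ≅ Q = ∃[ f ] IsOrderIsomorphism P._≈_ Q._≈_ P._≤_ Q._≤_ f
  where
  module P = Poset P
  module Q = Poset Q

------------------------------------------------------------------------
-- Complete lattices and κ-lattices

module _ {c ℓ₁ ℓ₂ : Level} (L : Poset c ℓ₁ ℓ₂) where

  open Poset L
  open PosetProperties L using (_<_)

  private
    variable
      p : Level

  Subset : Set (suc (c ⊔ ℓ₁ ⊔ ℓ₂))
  Subset = Pred Carrier (c ⊔ ℓ₁ ⊔ ℓ₂)

  IsGreatest : Pred Carrier p → Pred Carrier (c ⊔ ℓ₂ ⊔ p)
  IsGreatest X x = x ∈ X × (∀ {y} → y ∈ X → y ≤ x)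

  IsLeast : Pred Carrier p → Pred Carrier (c ⊔ ℓ₂ ⊔ p)
  IsLeast X x = x ∈ X × (∀ {y} → y ∈ X → x ≤ y)

  IsJoin : Pred Carrier p → Pred Carrier (c ⊔ ℓ₂ ⊔ p)
  IsJoin X = IsLeast (λ u → ∀ {x} → x ∈ X → x ≤ u)

  IsMeet : Pred Carrier p → Pred Carrier (c ⊔ ℓ₂ ⊔ p)
  IsMeet X = IsGreatest (λ l → ∀ {x} → x ∈ X → l ≤ x)

  IsBinaryJoin : Carrier → Carrier → Pred Carrier (c ⊔ ℓ₁ ⊔ ℓ₂)
  IsBinaryJoin x y = IsJoin ((_≈ x) ∪ (_≈ y))

  IsBinaryMeet : Carrier → Carrier → Pred Carrier (c ⊔ ℓ₁ ⊔ ℓ₂)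
  IsBinaryMeet x y = IsMeet ((_≈ x) ∪ (_≈ y))

  IsCompleteLattice : Set (suc (c ⊔ ℓ₁ ⊔ ℓ₂))
  IsCompleteLattice = ∀ (X : Subset) → ∃ (IsJoin X) × ∃ (IsMeet X)

  IsCompletelyJoinIrreducible : Pred Carrier (suc (c ⊔ ℓ₁ ⊔ ℓ₂))
  IsCompletelyJoinIrreducible j =
    ∀ (X : Subset) → X Respects _≈_ → IsJoin X j → j ∈ X

  IsCompletelyMeetIrreducible : Pred Carrier (suc (c ⊔ ℓ₁ ⊔ ℓ₂))
  IsCompletelyMeetIrreducible m =
    ∀ (X : Subset) → X Respects _≈_ → IsMeet X m → m ∈ X

  Jiᶜ : Setoid (suc (c ⊔ ℓ₁ ⊔ ℓ₂)) ℓ₁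
  Jiᶜ = On.setoid {B = Σ Carrier IsCompletelyJoinIrreducible} Eq.setoid proj₁

  Miᶜ : Setoid (suc (c ⊔ ℓ₁ ⊔ ℓ₂)) ℓ₁
  Miᶜ = On.setoid {B = Σ Carrier IsCompletelyMeetIrreducible} Eq.setoid proj₁

  -- The property determining j⁎ (respectively m*) up to _≈_.

  IsLowerStar : Carrier → Carrier → Set (c ⊔ ℓ₁ ⊔ ℓ₂)
  IsLowerStar j j⁎ = (λ x → x < j) ≐ (λ x → x ≤ j⁎)

  IsUpperStar : Carrier → Carrier → Set (c ⊔ ℓ₁ ⊔ ℓ₂)
  IsUpperStar m m* = (λ x → m < x) ≐ (λ x → m* ≤ x)

  record IsBiSpatial : Set (suc (c ⊔ ℓ₁ ⊔ ℓ₂)) where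
    field
      joins : ∀ x → Σ[ X ∈ Subset ] X ⊆ IsCompletelyJoinIrreducible × IsJoin X x
      meets : ∀ x → Σ[ X ∈ Subset ] X ⊆ IsCompletelyMeetIrreducible × IsMeet X x

  record IsκLattice : Set (suc (c ⊔ ℓ₁ ⊔ ℓ₂)) where
    field
      isComplete  : IsCompleteLattice
      isBiSpatial : IsBiSpatial
      bijections  : Inverse Jiᶜ Miᶜ

    open Inverse bijections public
      using () renaming (to to κ; from to κᵈ; to-cong to κ-cong; from-cong to κᵈ-cong)

    field
      κ-greatest : ∀ j → ∃[ j⁎ ] IsLowerStar (proj₁ j) j⁎ ×
        IsGreatest (λ y → IsBinaryMeet (proj₁ j) y j⁎) (proj₁ (κ j))
      κᵈ-least   : ∀ m → ∃[ m* ] IsUpperStar (proj₁ m) m* ×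
        IsLeast (λ x → IsBinaryJoin (proj₁ m) x m*) (proj₁ (κᵈ m))

  record IsWellSeparatedκLattice : Set (suc (c ⊔ ℓ₁ ⊔ ℓ₂)) where
    field
      isκLattice : IsκLattice

    open IsκLattice isκLattice public

    field
      separated : ∀ {z₁ z₂} → ¬ z₁ ≤ z₂ →
        ∃[ j ] proj₁ j ≤ z₁ × z₂ ≤ proj₁ (κ j)

------------------------------------------------------------------------
-- Maximal orthogonal pairs

module _ {s r : Level} {S : Set s} (_⟶_ : Rel S r) where

  rightPerp : ∀ {q} → Pred S q → Pred S (s ⊔ r ⊔ q)
  rightPerp X y = ∀ {x} → x ∈ X → ¬ x ⟶ y

  leftPerp : ∀ {q} → Pred S q → Pred S (s ⊔ r ⊔ q)
  leftPerp Y x = ∀ {y} → y ∈ Y → ¬ x ⟶ y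

  record MaximalOrthogonalPair : Set (suc (s ⊔ r)) where
    field
      fst   : Pred S (s ⊔ r)
      snd   : Pred S (s ⊔ r)
      snd-≐ : snd ≐ rightPerp fst
      fst-≐ : fst ≐ leftPerp snd

  open MaximalOrthogonalPair

  Pairs : Poset (suc (s ⊔ r)) (s ⊔ r) (s ⊔ r)
  Pairs = record
    { Carrier = MaximalOrthogonalPair
    ; _≈_     = λ P Q → fst P ≐ fst Q × snd P ≐ snd Q
    ; _≤_     = λ P Q → fst P ⊆ fst Q
    ; isPartialOrder = record
      { isPreorder = record
        { isEquivalence = record
          { refl  = ((λ z → z) , (λ z → z)) , ((λ z → z) , (λ z → z))
          ; sym   = λ { ((a , b) , (c , d)) → (b , a) , (d , c) }
          ; trans = λ { ((a , b) , (c , d)) ((a′ , b′) , (c′ , d′)) →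
              ((λ z → a′ (a z)) , (λ z → b (b′ z))) ,
              ((λ z → c′ (c z)) , (λ z → d (d′ z))) }
          }
        ; reflexive = λ { ((a , _) , _) → a }
        ; trans     = λ f g z → g (f z)
        }
      ; antisym = λ {P} {Q} f g →
          (f , g) , (sndMono P Q g , sndMono Q P f)
      }
    }
    where
    sndMono : ∀ P Q → fst Q ⊆ fst P → snd P ⊆ snd Q
    sndMono P Q g y∈ = proj₂ (snd-≐ Q) (λ x∈ → proj₁ (snd-≐ P) y∈ (g x∈))

------------------------------------------------------------------------
-- Factorization systems

module _ {s r : Level} {S : Set s} (_⟶_ : Rel S r) where

  Fact↠ : Rel S (s ⊔ r)
  Fact↠ x y = ∀ z → y ⟶ z → x ⟶ z

  Fact↪ : Rel S (s ⊔ r)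
  Fact↪ x y = ∀ z → z ⟶ x → z ⟶ y

Mult : ∀ {s r} {S : Set s} → Rel S r → Rel S r → Rel S (s ⊔ r)
Mult _↠_ _↪_ x z = ∃[ y ] x ↠ y × y ↪ z

-- A tuple (S, ⟶, ↠, ↪), with no axioms beyond well-definedness of the
-- relations on the setoid S.

record System (s e r : Level) : Set (suc (s ⊔ e ⊔ r)) where
  infix 4 _⟶_ _↠_ _↪_
  field
    setoid : Setoid s e

  open Setoid setoid public using (Carrier; _≈_)

  field
    _⟶_ _↠_ _↪_ : Rel Carrier r
    ⟶-resp-≈    : _⟶_ Respects₂ _≈_
    ↠-resp-≈    : _↠_ Respects₂ _≈_
    ↪-resp-≈    : _↪_ Respects₂ _≈_

module _ {s e r : Level} (F : System s e r) where

  open System F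

  record IsFactorizationSystem : Set (s ⊔ r) where
    field
      reflexive : Reflexive _⟶_
      fact-↠    : Fact↠ _⟶_ ⇔ _↠_
      fact-↪    : Fact↪ _⟶_ ⇔ _↪_
      mult      : Mult _↠_ _↪_ ⇔ _⟶_

  record IsTwoAcyclic : Set (s ⊔ e ⊔ r) where
    field
      order-↠ : Antisymmetric _≈_ _↠_
      order-↪ : Antisymmetric _≈_ _↪_
      brick   : ∀ {x y} → x ↠ y → y ↪ x → x ≈ y

  record IsTwoAcyclicFactorizationSystem : Set (s ⊔ e ⊔ r) where
    field
      isFactorizationSystem : IsFactorizationSystem
      isTwoAcyclic          : IsTwoAcyclic

-- IsOrderIsomorphism _≈₁_ _≈₂_ R₁ R₂ f, for arbitrary relations R₁ and R₂,
-- says that f is a bijection with R₁ x y if and only if R₂ (f x) (f y).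

record _≅ˢ_ {s e r s′ e′ r′ : Level} (F : System s e r) (G : System s′ e′ r′)
            : Set (s ⊔ e ⊔ r ⊔ s′ ⊔ e′ ⊔ r′) where
  private
    module F = System F
    module G = System G
  field
    to    : F.Carrier → G.Carrier
    ⟶-iso : IsOrderIsomorphism F._≈_ G._≈_ F._⟶_ G._⟶_ to
    ↠-iso : IsOrderIsomorphism F._≈_ G._≈_ F._↠_ G._↠_ to
    ↪-iso : IsOrderIsomorphism F._≈_ G._≈_ F._↪_ G._↪_ to

------------------------------------------------------------------------
-- The relations on Jiᶜ L, and the two components of the canonical pair

module _ {c ℓ₁ ℓ₂ : Level} {L : Poset c ℓ₁ ℓ₂} (K : IsκLattice L) where

  open Poset L
  open IsκLattice K

  jiSystem : System (suc (c ⊔ ℓ₁ ⊔ ℓ₂)) ℓ₁ ℓ₂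
  jiSystem = record
    { setoid   = Jiᶜ L
    ; _⟶_      = λ i j → ¬ proj₁ i ≤ proj₁ (κ j)
    ; _↠_      = λ i j → proj₁ j ≤ proj₁ i
    ; _↪_      = λ i j → proj₁ (κ j) ≤ proj₁ (κ i)
    ; ⟶-resp-≈ = (λ {i} {j} {k} j≈k i⟶j i≤κk →
                    i⟶j (≤-respʳ-≈ (Eq.sym (κ-cong {j} {k} j≈k)) i≤κk))
               , (λ i≈j i⟶k j≤κk → i⟶k (≤-respˡ-≈ (Eq.sym i≈j) j≤κk))
    ; ↠-resp-≈ = ≤-respˡ-≈ , ≤-respʳ-≈
    ; ↪-resp-≈ = (λ {i} {j} {k} j≈k → ≤-respˡ-≈ (κ-cong {j} {k} j≈k))
               , (λ {i} {j} {k} j≈k → ≤-respʳ-≈ (κ-cong {j} {k} j≈k))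
    }

  jiBelow : Carrier → Pred (Setoid.Carrier (Jiᶜ L)) ℓ₂
  jiBelow x j = proj₁ j ≤ x

  κᵈMiAbove : Carrier → Pred (Setoid.Carrier (Jiᶜ L)) (suc (c ⊔ ℓ₁ ⊔ ℓ₂))
  κᵈMiAbove x = image (Jiᶜ L) κᵈ (λ m → x ≤ proj₁ m)

  IsJoinOf : ∀ {q} → Pred (Setoid.Carrier (Jiᶜ L)) q → Carrier → Set (suc (c ⊔ ℓ₁ ⊔ ℓ₂) ⊔ q)
  IsJoinOf X = IsJoin L (image Eq.setoid proj₁ X)

  IsMeetOfκ : ∀ {q} → Pred (Setoid.Carrier (Jiᶜ L)) q → Carrier → Set (suc (c ⊔ ℓ₁ ⊔ ℓ₂) ⊔ q)
  IsMeetOfκ Y = IsMeet L (image Eq.setoid (λ j → proj₁ (κ j)) Y)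

  record CanonicalIsomorphism : Set (suc (suc (c ⊔ ℓ₁ ⊔ ℓ₂))) where
    private
      P = Pairs (System._⟶_ jiSystem)
      module P = Poset P
    open MaximalOrthogonalPair
    field
      toPair    : Carrier → P.Carrier
      toPair-≐  : ∀ x → fst (toPair x) ≐ jiBelow x × snd (toPair x) ≐ κᵈMiAbove x
      isIso     : IsOrderIsomorphism _≈_ P._≈_ _≤_ P._≤_ toPair
      fromPair  : P.Carrier → Carrier
      isJoin    : ∀ p → IsJoinOf (fst p) (fromPair p)
      isMeet    : ∀ p → IsMeetOfκ (snd p) (fromPair p)
      leftInv   : ∀ x → fromPair (toPair x) ≈ x
      rightInv  : ∀ p → toPair (fromPair p) P.≈ p

{-# OPTIONS --safe #-}
module Submission where

-- A two-acyclic factorization system on S whose lattice of pairs is L amounts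
-- to maps J, M : S → L with J join-dense, M meet-dense, x ⟶ y iff J x ≰ M y,
-- x ↠ y iff J x ≥ J y and x ↪ y iff M x ≥ M y.  Factorization and the brick
-- condition force J x ∧ M x to be the unique lower cover of J x and M x to be
-- the largest y with J x ∧ y = J x ∧ M x, so M plays the role of κ.  Recovering
-- L from S is then the fundamental theorem of concept lattices.

open import Axiom.DoubleNegationElimination using (em⇒dne)
open import Axiom.ExcludedMiddle using (ExcludedMiddle)
open import Data.Product using (Σ-syntax; ∃; ∃-syntax; _×_; _,_; proj₁; proj₂; map₂; swap)
open import Data.Sum using (inj₁; inj₂)
open import Function.Base using (_∘_; flip; id)
open import Function.Bundles using (_⇔_; mk⇔; Inverse)
open import Level using (Level; Lift; lift; lower; _⊔_; suc)
open import Relation.Binary.Bundles using (Poset; Setoid)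
open import Relation.Binary.Core using (Rel) renaming (_⇔_ to _⇔ᴿ_)
open import Relation.Binary.Morphism.Structures using (IsOrderIsomorphism)
open import Relation.Binary.PropositionalEquality using (_≡_; refl)
import Relation.Binary.Properties.Poset as PosetProperties
open import Relation.Nullary using (¬_)
open import Relation.Nullary.Decidable using (True; toWitness; fromWitness)
open import Relation.Unary using (Pred; _∈_; _⊆_; _≐_; _∪_)
open import Defs

private
  variable
    c ℓ₁ ℓ₂ s e r p q : Level

-- Bases of a poset and the systems they represent.

record IsBasis (L : Poset c ℓ₁ ℓ₂) (S : Setoid s e) (J M : Setoid.Carrier S → Poset.Carrier L)
               : Set (c ⊔ ℓ₁ ⊔ ℓ₂ ⊔ s ⊔ e) where
  private
    module L = Poset L
    module S = Setoid S
  field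
    J-cong      : ∀ {x y} → x S.≈ y → J x L.≈ J y
    M-cong      : ∀ {x y} → x S.≈ y → M x L.≈ M y
    J-injective : ∀ {x y} → J x L.≈ J y → x S.≈ y
    M-injective : ∀ {x y} → M x L.≈ M y → x S.≈ y
    J-dense     : ∀ {u v} → (∀ x → J x L.≤ u → J x L.≤ v) → u L.≤ v
    M-dense     : ∀ {u v} → (∀ x → v L.≤ M x → u L.≤ M x) → u L.≤ v
    irreflexive : ∀ x → ¬ J x L.≤ M x
    factor      : ∀ {x z} → ¬ J x L.≤ M z → ∃[ y ] J y L.≤ J x × M z L.≤ M y
    brick       : ∀ {x y} → J y L.≤ J x → M x L.≤ M y → x S.≈ y

record Represents (L : Poset c ℓ₁ ℓ₂) (F : System s e r)
                  (J M : System.Carrier F → Poset.Carrier L) : Set (ℓ₂ ⊔ s ⊔ r) where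
  open Poset L using (_≤_)
  open System F using (_⟶_; _↠_; _↪_)
  field
    ⟶-iff : _⟶_ ⇔ᴿ (λ x y → ¬ J x ≤ M y)
    ↠-iff : _↠_ ⇔ᴿ (λ x y → J y ≤ J x)
    ↪-iff : _↪_ ⇔ᴿ (λ x y → M y ≤ M x)

-- The conditions making m the greatest y with j ∧ y = j ∧ m and j ∧ m = j⁎,
-- in terms of the order alone so that they can be dualized.
record Isκ (L : Poset c ℓ₁ ℓ₂) (j m : Poset.Carrier L) : Set (c ⊔ ℓ₂) where
  open Poset L using (_≤_)
  field
    j≰m      : ¬ j ≤ m
    below    : ∀ {u} → u ≤ j → ¬ j ≤ u → u ≤ m
    greatest : ∀ {y} → (∀ {u} → u ≤ j → u ≤ m → u ≤ y) → ¬ j ≤ y → y ≤ m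

dualPoset : Poset c ℓ₁ ℓ₂ → Poset c ℓ₁ ℓ₂
dualPoset = PosetProperties.≥-poset

-- The axioms of a basis are self-dual, so every result about `J` and joins yields one about `M` and
-- meets.
dualBasis : {L : Poset c ℓ₁ ℓ₂} {S : Setoid s e} {J M : Setoid.Carrier S → Poset.Carrier L} →
            IsBasis L S J M → IsBasis (dualPoset L) S M J
dualBasis B = record
  { J-cong      = M-cong
  ; M-cong      = J-cong
  ; J-injective = M-injective
  ; M-injective = J-injective
  ; J-dense     = M-dense
  ; M-dense     = J-dense
  ; irreflexive = irreflexive
  ; factor      = λ n → let y , a , b = factor n in y , b , a
  ; brick       = flip brick
  }
  where open IsBasis B

-- Irreducibility, lower covers and the greatest-element property.

module _ (L : Poset c ℓ₁ ℓ₂) where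

  open Poset L renaming (refl to ≤-refl; trans to ≤-trans)

  Isκ-respˡ-≈ : ∀ {j k m} → j ≈ k → Isκ L j m → Isκ L k m
  Isκ-respˡ-≈ j≈k κ = record
    { j≰m      = j≰m ∘ ≤-respˡ-≈ (Eq.sym j≈k)
    ; below    = λ u≤k k≰u → below (≤-respʳ-≈ (Eq.sym j≈k) u≤k) (k≰u ∘ ≤-respˡ-≈ j≈k)
    ; greatest = λ h k≰y → greatest (λ u≤j → h (≤-respʳ-≈ j≈k u≤j)) (k≰y ∘ ≤-respˡ-≈ j≈k)
    }
    where open Isκ κ

  -- If `j` were not in `X`, every member of `X` would be strictly below `j`, hence below `m`; then
  -- the join `j` would be below `m`.
  Isκ⇒completelyJoinIrreducible : ∀ {j m} → (∀ {a} → ExcludedMiddle a) → Isκ L j m →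
                                  IsCompletelyJoinIrreducible L j
  Isκ⇒completelyJoinIrreducible {j} {m} em κ X resp (j-ub , j-least) = em⇒dne em λ j∉X →
    j≰m (j-least λ x∈X → below (j-ub x∈X) λ j≤x →
      j∉X (resp (antisym (j-ub x∈X) j≤x) x∈X))
    where open Isκ κ

  Isκ⇒isLowerStar : ∀ {j m n} → Isκ L j m → IsBinaryMeet L j m n → IsLowerStar L j n
  Isκ⇒isLowerStar κ (n-lb , n-greatest) =
      (λ (x≤j , x≉j) → n-greatest λ where
        (inj₁ z≈j) → ≤-respʳ-≈ (Eq.sym z≈j) x≤j
        (inj₂ z≈m) → ≤-respʳ-≈ (Eq.sym z≈m) (below x≤j (x≉j ∘ antisym x≤j)))
    , λ x≤n → ≤-trans x≤n (n-lb (inj₁ Eq.refl))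
            , λ x≈j → j≰m (≤-trans (reflexive (Eq.sym x≈j)) (≤-trans x≤n (n-lb (inj₂ Eq.refl))))
    where open Isκ κ

  -- Every lower star of `j` is the meet of `j` and `m`. Leaving `j⁎` arbitrary lets the lemma apply
  -- also to the star that a given κ-lattice supplies, which is how its `κ` is later identified with
  -- `M`.
  Isκ⇒isGreatest : ∀ {j m j⁎} → Isκ L j m → IsLowerStar L j j⁎ →
                   IsGreatest L (λ y → IsBinaryMeet L j y j⁎) m
  Isκ⇒isGreatest {j} {m} {j⁎} κ (<⇒≤⁎ , ≤⁎⇒<) =
      ( (λ where
          (inj₁ z≈j) → ≤-respʳ-≈ (Eq.sym z≈j) j⁎≤j
          (inj₂ z≈m) → ≤-respʳ-≈ (Eq.sym z≈m) (below j⁎≤j j≰j⁎))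
      , λ lb → ≤m⇒≤⁎ (lb (inj₁ Eq.refl)) (lb (inj₂ Eq.refl)))
    , λ (j⁎-lb , j⁎-greatest) → greatest
        (λ u≤j u≤m → ≤-trans (≤m⇒≤⁎ u≤j u≤m) (j⁎-lb (inj₂ Eq.refl)))
        (λ j≤y → j≰j⁎ (j⁎-greatest λ where
          (inj₁ z≈j) → reflexive (Eq.sym z≈j)
          (inj₂ z≈y) → ≤-respʳ-≈ (Eq.sym z≈y) j≤y))
    where
    open Isκ κ
    j⁎≤j : j⁎ ≤ j
    j⁎≤j = proj₁ (≤⁎⇒< ≤-refl)
    j≰j⁎ : ¬ j ≤ j⁎
    j≰j⁎ j≤j⁎ = proj₂ (≤⁎⇒< ≤-refl) (antisym j⁎≤j j≤j⁎)
    ≤m⇒≤⁎ : ∀ {u} → u ≤ j → u ≤ m → u ≤ j⁎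
    ≤m⇒≤⁎ u≤j u≤m = <⇒≤⁎ (u≤j , λ u≈j → j≰m (≤-respˡ-≈ u≈j u≤m))

  IsGreatest-unique : ∀ {X : Pred Carrier p} {x y} → IsGreatest L X x → IsGreatest L X y → x ≈ y
  IsGreatest-unique (x∈X , x-max) (y∈X , y-max) = antisym (y-max x∈X) (x-max y∈X)

  IsJoin-resp-≐ : ∀ {X : Pred Carrier p} {Y : Pred Carrier q} {u} → X ≐ Y → IsJoin L X u → IsJoin L Y u
  IsJoin-resp-≐ (X⊆Y , Y⊆X) (u-ub , u-least) = u-ub ∘ Y⊆X , λ v-ub → u-least (v-ub ∘ X⊆Y)

-- Classical logic: resizing of subsets, joins and meets.

module Classical (em : ∀ {a} → ExcludedMiddle a) where

  dne : {P : Set p} → ¬ ¬ P → P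
  dne = em⇒dne em

  -- `True` of a decision lives at level zero and can be lifted to any level. Predicates of any
  -- level can thus serve where completeness, irreducibility or pairs ask for subsets at one fixed
  -- level.
  resize : {A : Set s} → ∀ q → Pred A p → Pred A q
  resize q X x = Lift q (True (em {P = X x}))

  resize-≐ : {A : Set s} (X : Pred A p) → resize q X ≐ X
  resize-≐ X = (λ x∈ → toWitness (lower x∈)) , λ x∈ → lift (fromWitness x∈)

  module _ (L : Poset c ℓ₁ ℓ₂) (complete : IsCompleteLattice L) where

    open Poset L using (Carrier)

    join : (X : Pred Carrier p) → ∃ (IsJoin L X)
    join X = map₂ (IsJoin-resp-≐ L (resize-≐ X)) (proj₁ (complete (resize _ X)))

  dualComplete : (L : Poset c ℓ₁ ℓ₂) → IsCompleteLattice L → IsCompleteLattice (dualPoset L)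
  dualComplete L complete X = swap (complete X)

  meet : (L : Poset c ℓ₁ ℓ₂) → IsCompleteLattice L → (X : Pred (Poset.Carrier L) p) → ∃ (IsMeet L X)
  meet L complete = join (dualPoset L) (dualComplete L complete)

  -- Order-theoretic consequences of the basis axioms.

  module BasisProperties {L : Poset c ℓ₁ ℓ₂} {S : Setoid s e}
                         {J M : Setoid.Carrier S → Poset.Carrier L} (B : IsBasis L S J M) where

    open Poset L renaming (refl to ≤-refl; trans to ≤-trans)
    open IsBasis B

    isκ : ∀ x → Isκ L (J x) (M x)
    isκ x = record { j≰m = irreflexive x ; below = below ; greatest = greatest }
      where
      -- Suppose `J z ≤ u` but not `J z ≤ M x`. The middle term `w` of the factorization satisfies
      -- the brick condition with `x`, so `J x ≈ J w ≤ J z ≤ u`, a contradiction.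
      below : ∀ {u} → u ≤ J x → ¬ J x ≤ u → u ≤ M x
      below {u} u≤Jx Jx≰u = J-dense λ z Jz≤u → dne λ Jz≰Mx →
        let w , Jw≤Jz , Mx≤Mw = factor Jz≰Mx
            x≈w = brick (≤-trans Jw≤Jz (≤-trans Jz≤u u≤Jx)) Mx≤Mw
        in Jx≰u (≤-respˡ-≈ (Eq.sym (J-cong x≈w)) (≤-trans Jw≤Jz Jz≤u))

      -- If J t ≤ y but J t ≰ M x, then J x ≤ y: any z with y ≤ M z and
      -- J x ≰ M z gives a factorization through v, where v ≈ x contradicts
      -- the factorization of (t, x), and J v < J x contradicts the hypothesis.
      greatest : ∀ {y} → (∀ {u} → u ≤ J x → u ≤ M x → u ≤ y) → ¬ J x ≤ y → y ≤ M x
      greatest {y} h Jx≰y = J-dense λ t Jt≤y → dne λ Jt≰Mx →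
        let w , Jw≤Jt , Mx≤Mw = factor Jt≰Mx in
        Jx≰y (M-dense λ z y≤Mz → dne λ Jx≰Mz →
          let v , Jv≤Jx , Mz≤Mv = factor Jx≰Mz
              Jx≰Jv = λ Jx≤Jv →
                let Mv≈Mx = M-cong (J-injective (antisym Jv≤Jx Jx≤Jv)) in
                irreflexive w (≤-trans Jw≤Jt (≤-trans Jt≤y (≤-trans y≤Mz
                  (≤-trans Mz≤Mv (≤-respˡ-≈ (Eq.sym Mv≈Mx) Mx≤Mw)))))
          in irreflexive v (≤-trans (h Jv≤Jx (below Jv≤Jx Jx≰Jv)) (≤-trans y≤Mz Mz≤Mv)))

    J-isJoin : ∀ u → IsJoin L (image Eq.setoid J (λ x → J x ≤ u)) u
    J-isJoin u = (λ (x , Jx≤u , z≈Jx) → ≤-respˡ-≈ (Eq.sym z≈Jx) Jx≤u)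
               , λ v-ub → J-dense λ x Jx≤u → v-ub (x , Jx≤u , Eq.refl)

    -- By density `j` is the join of the elements `J x` below it, and irreducibility makes `j` one
    -- of them.
    completelyJoinIrreducible⇒J : ∀ {j} → IsCompletelyJoinIrreducible L j → ∃[ x ] j ≈ J x
    completelyJoinIrreducible⇒J {j} cji =
      let x , _ , j≈Jx = proj₁ (resize-≐ X) (cji (resize _ X)
            (λ u≈v u∈ → proj₂ (resize-≐ X)
              (map₂ (map₂ (Eq.trans (Eq.sym u≈v))) (proj₁ (resize-≐ X) u∈)))
            (IsJoin-resp-≐ L (swap (resize-≐ X)) (J-isJoin j)))
      in x , j≈Jx
      where X = image Eq.setoid J (λ x → J x ≤ j)

    J-isCompletelyJoinIrreducible : ∀ x → IsCompletelyJoinIrreducible L (J x)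
    J-isCompletelyJoinIrreducible x = Isκ⇒completelyJoinIrreducible L em (isκ x)

    joinOfIrreducibles : ∀ u → Σ[ X ∈ Subset L ] X ⊆ IsCompletelyJoinIrreducible L × IsJoin L X u
    joinOfIrreducibles u =
        resize _ X
      , (λ v∈ → let x , _ , v≈Jx = proj₁ (resize-≐ X) v∈ in
          Isκ⇒completelyJoinIrreducible L em (Isκ-respˡ-≈ L (Eq.sym v≈Jx) (isκ x)))
      , IsJoin-resp-≐ L (swap (resize-≐ X)) (J-isJoin u)
      where X = image Eq.setoid J (λ x → J x ≤ u)

    κ-isGreatest : IsCompleteLattice L → ∀ {j x} → j ≈ J x →
                   ∃[ j⁎ ] IsLowerStar L j j⁎ × IsGreatest L (λ y → IsBinaryMeet L j y j⁎) (M x)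
    κ-isGreatest complete {j} {x} j≈Jx =
      let n , n-meet = meet L complete ((_≈ j) ∪ (_≈ M x))
          κ          = Isκ-respˡ-≈ L (Eq.sym j≈Jx) (isκ x)
          star       = Isκ⇒isLowerStar L κ n-meet
      in n , star , Isκ⇒isGreatest L κ star

  -- From a basis of a complete lattice to a well separated κ-lattice.

  module _ {L : Poset c ℓ₁ ℓ₂} {S : Setoid s e} {J M : Setoid.Carrier S → Poset.Carrier L}
           (B : IsBasis L S J M) (complete : IsCompleteLattice L) where

    open Poset L renaming (refl to ≤-refl; trans to ≤-trans)
    open IsBasis B
    private
      module ∨ = BasisProperties B
      module ∧ = BasisProperties (dualBasis B)

    basis⇒wellSeparated : IsWellSeparatedκLattice L
    basis⇒wellSeparated = record
      { isκLattice = record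
        { isComplete  = complete
        ; isBiSpatial = record { joins = ∨.joinOfIrreducibles ; meets = ∧.joinOfIrreducibles }
        -- Both maps go through the index set, matching `J x` with `M x`. Injectivity of `J` and `M`
        -- makes the index unique up to equality.
        ; bijections  = record
          { to        = λ (_ , cji) → let x , _ = ∨.completelyJoinIrreducible⇒J cji in
                          M x , ∧.J-isCompletelyJoinIrreducible x
          ; from      = λ (_ , cmi) → let x , _ = ∧.completelyJoinIrreducible⇒J cmi in
                          J x , ∨.J-isCompletelyJoinIrreducible x
          ; to-cong   = λ {(_ , cji)} {(_ , cji′)} j≈j′ →
              let _ , j≈Jx  = ∨.completelyJoinIrreducible⇒J cji
                  _ , j′≈Jy = ∨.completelyJoinIrreducible⇒J cji′
              in M-cong (J-injective (Eq.trans (Eq.sym j≈Jx) (Eq.trans j≈j′ j′≈Jy)))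
          ; from-cong = λ {(_ , cmi)} {(_ , cmi′)} m≈m′ →
              let _ , m≈Mx  = ∧.completelyJoinIrreducible⇒J cmi
                  _ , m′≈My = ∧.completelyJoinIrreducible⇒J cmi′
              in J-cong (M-injective (Eq.trans (Eq.sym m≈Mx) (Eq.trans m≈m′ m′≈My)))
          ; inverse   =
              (λ {(_ , cmi)} {(_ , cji)} j≈Jx →
                let _ , m≈Mx = ∧.completelyJoinIrreducible⇒J cmi
                    _ , j≈Jy = ∨.completelyJoinIrreducible⇒J cji
                in Eq.trans (M-cong (J-injective (Eq.trans (Eq.sym j≈Jy) j≈Jx))) (Eq.sym m≈Mx))
            , (λ {(_ , cji)} {(_ , cmi)} m≈Mx →
                let _ , j≈Jx = ∨.completelyJoinIrreducible⇒J cji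
                    _ , m≈My = ∧.completelyJoinIrreducible⇒J cmi
                in Eq.trans (J-cong (M-injective (Eq.trans (Eq.sym m≈My) m≈Mx))) (Eq.sym j≈Jx))
          }
        ; κ-greatest = λ (_ , cji) →
            ∨.κ-isGreatest complete (proj₂ (∨.completelyJoinIrreducible⇒J cji))
        ; κᵈ-least   = λ (_ , cmi) →
            let m* , (<⇒≤* , ≤*⇒<) , least = ∧.κ-isGreatest (dualComplete L complete)
                                               (proj₂ (∧.completelyJoinIrreducible⇒J cmi))
            -- A lower star in the dual poset is an upper star, except that strictness there negates
            -- `x ≈ m` instead of `m ≈ x`.
            in m* , ( (λ (m≤x , m≉x) → <⇒≤* (m≤x , m≉x ∘ Eq.sym))
                    , (λ m*≤x → map₂ (_∘ Eq.sym) (≤*⇒< m*≤x)))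
                  , least
        }
      -- By the two densities, `z₁ ≰ z₂` gives `J x ≤ z₁` and `z₂ ≤ M t` with `J x ≰ M t`; the
      -- middle term `w` of a factorization separates. Here `κ` of `J w` is `M y` for the index `y`
      -- chosen from irreducibility, so `y` has to be compared with `w`.
      ; separated = λ z₁≰z₂ → dne λ h →
          z₁≰z₂ (M-dense λ t z₂≤Mt → J-dense λ x Jx≤z₁ → dne λ Jx≰Mt →
            let w , Jw≤Jx , Mt≤Mw = factor Jx≰Mt
                cji               = ∨.J-isCompletelyJoinIrreducible w
                y , Jw≈Jy         = ∨.completelyJoinIrreducible⇒J cji
            in h ( (J w , cji) , ≤-trans Jw≤Jx Jx≤z₁
                 , ≤-respʳ-≈ (M-cong (J-injective Jw≈Jy)) (≤-trans z₂≤Mt Mt≤Mw)))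
      }

  -- The fundamental theorem of concept lattices for a basis.

  module ConceptLattice {L : Poset c ℓ₁ ℓ₂} {S : Setoid s e} {J M : Setoid.Carrier S → Poset.Carrier L}
                        (B : IsBasis L S J M) (complete : IsCompleteLattice L)
                        {_⟶_ : Rel (Setoid.Carrier S) r}
                        (⟶-iff : _⟶_ ⇔ᴿ (λ x y → ¬ Poset._≤_ L (J x) (M y))) where

    open Poset L renaming (refl to ≤-refl; trans to ≤-trans)
    open IsBasis B
    open MaximalOrthogonalPair
    private
      module P = Poset (Pairs _⟶_)

    ≤⇒¬⟶ : ∀ {x y} → J x ≤ M y → ¬ x ⟶ y
    ≤⇒¬⟶ Jx≤My x⟶y = proj₁ ⟶-iff x⟶y Jx≤My

    ¬⟶⇒≤ : ∀ {x y} → ¬ x ⟶ y → J x ≤ M y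
    ¬⟶⇒≤ ¬x⟶y = dne (¬x⟶y ∘ proj₂ ⟶-iff)

    Below Above : Carrier → Pred (Setoid.Carrier S) (s ⊔ r)
    Below u = resize _ (λ x → J x ≤ u)
    Above u = resize _ (λ x → u ≤ M x)

    Below-≐ : ∀ u → Below u ≐ (λ x → J x ≤ u)
    Below-≐ u = resize-≐ (λ x → J x ≤ u)

    Above-≐ : ∀ u → Above u ≐ (λ x → u ≤ M x)
    Above-≐ u = resize-≐ (λ x → u ≤ M x)

    -- `J`-density makes `Above u` the whole right perp of `Below u`, and `M`-density makes
    -- `Below u` the whole left perp of `Above u`.
    toPair : Carrier → P.Carrier
    toPair u = record
      { fst   = Below u
      ; snd   = Above u
      ; snd-≐ = (λ y∈ x∈ → ≤⇒¬⟶ (≤-trans (proj₁ (Below-≐ u) x∈) (proj₁ (Above-≐ u) y∈)))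
              , λ h → proj₂ (Above-≐ u) (J-dense λ x Jx≤u → ¬⟶⇒≤ (h (proj₂ (Below-≐ u) Jx≤u)))
      ; fst-≐ = (λ x∈ y∈ → ≤⇒¬⟶ (≤-trans (proj₁ (Below-≐ u) x∈) (proj₁ (Above-≐ u) y∈)))
              , λ h → proj₂ (Below-≐ u) (M-dense λ y u≤My → ¬⟶⇒≤ (h (proj₂ (Above-≐ u) u≤My)))
      }

    toPair-mono : ∀ {u v} → u ≤ v → toPair u P.≤ toPair v
    toPair-mono {u} {v} u≤v x∈ = proj₂ (Below-≐ v) (≤-trans (proj₁ (Below-≐ u) x∈) u≤v)

    toPair-cancel : ∀ {u v} → toPair u P.≤ toPair v → u ≤ v
    toPair-cancel {u} {v} h = J-dense λ x Jx≤u → proj₁ (Below-≐ v) (h (proj₂ (Below-≐ u) Jx≤u))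

    toPair-cong : ∀ {u v} → u ≈ v → toPair u P.≈ toPair v
    toPair-cong {u} {v} u≈v = P.antisym {toPair u} {toPair v}
      (toPair-mono (reflexive u≈v)) (toPair-mono (reflexive (Eq.sym u≈v)))

    fromPair : P.Carrier → Carrier
    fromPair P = proj₁ (join L complete (image Eq.setoid J (fst P)))

    isJoin : ∀ P → IsJoin L (image Eq.setoid J (fst P)) (fromPair P)
    isJoin P = proj₂ (join L complete (image Eq.setoid J (fst P)))

    J≤fromPair : ∀ P {x} → x ∈ fst P → J x ≤ fromPair P
    J≤fromPair P {x} x∈ = proj₁ (isJoin P) (x , x∈ , Eq.refl)

    fromPair≤M : ∀ P {y} → y ∈ snd P → fromPair P ≤ M y
    fromPair≤M P y∈ = proj₂ (isJoin P) λ (x , x∈ , z≈Jx) →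
      ≤-respˡ-≈ (Eq.sym z≈Jx) (¬⟶⇒≤ (proj₁ (snd-≐ P) y∈ x∈))

    -- Taking the join adds no new generators: the join lies below `M y` for each `y` in the second
    -- component, so `x` is orthogonal to that component and maximality applies.
    J≤fromPair⇒∈ : ∀ P {x} → J x ≤ fromPair P → x ∈ fst P
    J≤fromPair⇒∈ P Jx≤ = proj₂ (fst-≐ P) λ y∈ → ≤⇒¬⟶ (≤-trans Jx≤ (fromPair≤M P y∈))

    -- If `J x` is below a lower bound of the `M y`, then `x` lies in the first component, so `J x`
    -- is one of the joinands.
    isMeet : ∀ P → IsMeet L (image Eq.setoid M (snd P)) (fromPair P)
    isMeet P = (λ (y , y∈ , z≈My) → ≤-respʳ-≈ (Eq.sym z≈My) (fromPair≤M P y∈))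
             , λ l-lb → J-dense λ x Jx≤l → J≤fromPair P (proj₂ (fst-≐ P) λ {y} y∈ →
                 ≤⇒¬⟶ (≤-trans Jx≤l (l-lb (y , y∈ , Eq.refl))))

    toPair-fromPair : ∀ P → toPair (fromPair P) P.≈ P
    toPair-fromPair P = P.antisym {toPair (fromPair P)} {P}
      (J≤fromPair⇒∈ P ∘ proj₁ (Below-≐ (fromPair P)))
      (proj₂ (Below-≐ (fromPair P)) ∘ J≤fromPair P)

    fromPair-toPair : ∀ u → fromPair (toPair u) ≈ u
    -- `toPair` reflects the order, so this inverse law follows from the other one at `toPair u`.
    fromPair-toPair u = antisym (toPair-cancel (proj₁ (proj₁ (toPair-fromPair (toPair u)))))
                                (toPair-cancel (proj₂ (proj₁ (toPair-fromPair (toPair u)))))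

    toPair-isOrderIsomorphism : IsOrderIsomorphism _≈_ P._≈_ _≤_ P._≤_ toPair
    toPair-isOrderIsomorphism = record
      { isOrderMonomorphism = record
        { isOrderHomomorphism = record { cong = toPair-cong ; mono = toPair-mono }
        ; injective = λ ((h , h′) , _) → antisym (toPair-cancel h) (toPair-cancel h′)
        ; cancel    = toPair-cancel
        }
      ; surjective = λ P → fromPair P , λ {u} u≈ →
          P.Eq.trans {toPair u} {toPair (fromPair P)} {P} (toPair-cong u≈) (toPair-fromPair P)
      }

  -- From a basis to the axioms of a two-acyclic factorization system.

  module _ {L : Poset c ℓ₁ ℓ₂} {F : System s e r} {J M : System.Carrier F → Poset.Carrier L}
           (B : IsBasis L (System.setoid F) J M) (R : Represents L F J M) where

    open Poset L renaming (refl to ≤-refl; trans to ≤-trans)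
    open IsBasis B
    open Represents R

    -- By `M`-density, `J y ≤ J x` can be tested against all `M z`, and the contrapositive of this
    -- test is the definition of `Fact↠`; `J`-density does the same for `Fact↪`. Multiplication is
    -- `factor` together with `irreflexive`.
    basis⇒twoAcyclic : IsTwoAcyclicFactorizationSystem F
    basis⇒twoAcyclic = record
      { isFactorizationSystem = record
        { reflexive = λ {x} → proj₂ ⟶-iff (irreflexive x)
        ; fact-↠    =
            (λ h → proj₂ ↠-iff (M-dense λ z Jx≤Mz → dne λ Jy≰Mz →
              proj₁ ⟶-iff (h z (proj₂ ⟶-iff Jy≰Mz)) Jx≤Mz))
          , (λ x↠y z y⟶z → proj₂ ⟶-iff λ Jx≤Mz →
              proj₁ ⟶-iff y⟶z (≤-trans (proj₁ ↠-iff x↠y) Jx≤Mz))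
        ; fact-↪    =
            (λ h → proj₂ ↪-iff (J-dense λ z Jz≤My → dne λ Jz≰Mx →
              proj₁ ⟶-iff (h z (proj₂ ⟶-iff Jz≰Mx)) Jz≤My))
          , (λ x↪y z z⟶x → proj₂ ⟶-iff λ Jz≤My →
              proj₁ ⟶-iff z⟶x (≤-trans Jz≤My (proj₁ ↪-iff x↪y)))
        ; mult      =
            (λ (y , x↠y , y↪z) → proj₂ ⟶-iff λ Jx≤Mz →
              irreflexive y (≤-trans (proj₁ ↠-iff x↠y) (≤-trans Jx≤Mz (proj₁ ↪-iff y↪z))))
          , (λ x⟶z → let y , Jy≤Jx , Mz≤My = factor (proj₁ ⟶-iff x⟶z) in
              y , proj₂ ↠-iff Jy≤Jx , proj₂ ↪-iff Mz≤My)
        }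
      ; isTwoAcyclic = record
        { order-↠ = λ x↠y y↠x → J-injective (antisym (proj₁ ↠-iff y↠x) (proj₁ ↠-iff x↠y))
        ; order-↪ = λ x↪y y↪x → M-injective (antisym (proj₁ ↪-iff y↪x) (proj₁ ↪-iff x↪y))
        ; brick   = λ x↠y y↪x → brick (proj₁ ↠-iff x↠y) (proj₁ ↪-iff y↪x)
        }
      }

  -- The basis of a well separated κ-lattice.

  module _ {L : Poset c ℓ₁ ℓ₂} (K : IsκLattice L) where

    open Poset L renaming (refl to ≤-refl; trans to ≤-trans)
    open IsκLattice K
    open IsBiSpatial isBiSpatial
    open Inverse bijections using (strictlyInverseˡ; strictlyInverseʳ)

    -- Bi-spatiality gives both densities, since each completely meet-irreducible element is `κ` of
    -- its `κᵈ`. Separation, applied to `z₁` irreducible and `z₂` a value of `κ`, is factorization.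
    κ-basis : (∀ {z₁ z₂} → ¬ z₁ ≤ z₂ → ∃[ j ] proj₁ j ≤ z₁ × z₂ ≤ proj₁ (κ j)) →
              IsBasis L (Jiᶜ L) proj₁ (proj₁ ∘ κ)
    κ-basis separated = record
      { J-cong      = id
      ; M-cong      = λ {i} {j} → κ-cong {i} {j}
      ; J-injective = id
      ; M-injective = λ {i} {j} κi≈κj → Eq.trans (Eq.sym (strictlyInverseʳ i))
                        (Eq.trans (κᵈ-cong {κ i} {κ j} κi≈κj) (strictlyInverseʳ j))
      ; J-dense     = λ {u} h → let _ , irreducible , u-ub , u-least = joins u in
                        u-least λ {j} j∈ → h (j , irreducible j∈) (u-ub j∈)
      ; M-dense     = λ {_} {v} h → let _ , irreducible , v-lb , v-greatest = meets v in
                        v-greatest λ {m} m∈ →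
                          let κκᵈm≈m = strictlyInverseˡ (m , irreducible m∈) in
                          ≤-respʳ-≈ κκᵈm≈m (h (κᵈ (m , irreducible m∈))
                            (≤-respʳ-≈ (Eq.sym κκᵈm≈m) (v-lb m∈)))
      ; irreflexive = j≰κj
      ; factor      = separated
      ; brick       = brick
      }
      where
      -- The meet of `j` and `κ j` is `j⁎`, so `j ≤ κ j` would give `j ≤ j⁎ < j`.
      j≰κj : ∀ j → ¬ proj₁ j ≤ proj₁ (κ j)
      j≰κj j j≤κj =
        let _ , (_ , ≤⁎⇒<) , (_ , j⁎-greatest) , _ = κ-greatest j in
        proj₂ (≤⁎⇒< (j⁎-greatest λ where
          (inj₁ z≈j)  → reflexive (Eq.sym z≈j)
          (inj₂ z≈κj) → ≤-respʳ-≈ (Eq.sym z≈κj) j≤κj)) Eq.refl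

      -- If `j` were strictly below `i`, then `j ≤ i⁎ ≤ κ i ≤ κ j`, which is impossible.
      brick : ∀ {i j} → proj₁ j ≤ proj₁ i → proj₁ (κ i) ≤ proj₁ (κ j) → proj₁ i ≈ proj₁ j
      brick {i} {j} j≤i κi≤κj = dne λ i≉j →
        let _ , (<⇒≤⁎ , _) , (i⁎-lb , _) , _ = κ-greatest i
        in j≰κj j (≤-trans (<⇒≤⁎ (j≤i , i≉j ∘ Eq.sym)) (≤-trans (i⁎-lb (inj₂ Eq.refl)) κi≤κj))

    jiSystem-represents : Represents L (jiSystem K) proj₁ (proj₁ ∘ κ)
    jiSystem-represents = record { ⟶-iff = id , id ; ↠-iff = id , id ; ↪-iff = id , id }

  -- Lifting systems to higher universe levels.

  liftSystem : ∀ s′ e′ r′ → System s e r → System (s′ ⊔ s) (e′ ⊔ e) (r′ ⊔ r)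
  liftSystem s′ e′ r′ F = record
    { setoid   = record
      { Carrier       = Lift s′ F.Carrier
      ; _≈_           = λ x y → Lift e′ (lower x F.≈ lower y)
      ; isEquivalence = record
        { refl  = lift F.refl
        ; sym   = λ x≈y → lift (F.sym (lower x≈y))
        ; trans = λ x≈y y≈z → lift (F.trans (lower x≈y) (lower y≈z))
        }
      }
    ; _⟶_      = λ x y → Lift r′ (lower x F.⟶ lower y)
    ; _↠_      = λ x y → Lift r′ (lower x F.↠ lower y)
    ; _↪_      = λ x y → Lift r′ (lower x F.↪ lower y)
    ; ⟶-resp-≈ = (λ y≈z x⟶y → lift (proj₁ F.⟶-resp-≈ (lower y≈z) (lower x⟶y)))
               , (λ y≈z y⟶x → lift (proj₂ F.⟶-resp-≈ (lower y≈z) (lower y⟶x)))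
    ; ↠-resp-≈ = (λ y≈z x↠y → lift (proj₁ F.↠-resp-≈ (lower y≈z) (lower x↠y)))
               , (λ y≈z y↠x → lift (proj₂ F.↠-resp-≈ (lower y≈z) (lower y↠x)))
    ; ↪-resp-≈ = (λ y≈z x↪y → lift (proj₁ F.↪-resp-≈ (lower y≈z) (lower x↪y)))
               , (λ y≈z y↪x → lift (proj₂ F.↪-resp-≈ (lower y≈z) (lower y↪x)))
    }
    where
    module F where
      open System F public
      open Setoid setoid public using (refl; sym; trans)

  module _ {L : Poset c ℓ₁ ℓ₂} {F : System s e r} {J M : System.Carrier F → Poset.Carrier L} where

    liftBasis : ∀ s′ e′ r′ → IsBasis L (System.setoid F) J M →
                IsBasis L (System.setoid (liftSystem s′ e′ r′ F)) (J ∘ lower) (M ∘ lower)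
    liftBasis s′ e′ r′ B = record
      { J-cong      = J-cong ∘ lower
      ; M-cong      = M-cong ∘ lower
      ; J-injective = lift ∘ J-injective
      ; M-injective = lift ∘ M-injective
      ; J-dense     = λ h → J-dense (h ∘ lift)
      ; M-dense     = λ h → M-dense (h ∘ lift)
      ; irreflexive = irreflexive ∘ lower
      ; factor      = λ n → let y , a , b = factor n in lift y , a , b
      ; brick       = λ a b → lift (brick a b)
      }
      where open IsBasis B

    liftRepresents : ∀ s′ e′ r′ → Represents L F J M →
                     Represents L (liftSystem s′ e′ r′ F) (J ∘ lower) (M ∘ lower)
    liftRepresents s′ e′ r′ R = record
      { ⟶-iff = proj₁ ⟶-iff ∘ lower , lift ∘ proj₂ ⟶-iff
      ; ↠-iff = proj₁ ↠-iff ∘ lower , lift ∘ proj₂ ↠-iff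
      ; ↪-iff = proj₁ ↪-iff ∘ lower , lift ∘ proj₂ ↪-iff
      }
      where open Represents R

  -- The canonical isomorphism and the realization by pairs.

  wellSeparated⇒canonicalIsomorphism : {L : Poset c ℓ₁ ℓ₂} (K : IsWellSeparatedκLattice L) →
    CanonicalIsomorphism (IsWellSeparatedκLattice.isκLattice K)
  wellSeparated⇒canonicalIsomorphism {L = L} K = record
    { toPair   = toPair
    ; toPair-≐ = λ u → Below-≐ u
        -- `Above u` consists of the `j` with `u ≤ κ j`; the inverse laws of `κ` and `κᵈ` turn this
        -- into the image under `κᵈ`.
        , (λ {j} j∈ → κ j , proj₁ (Above-≐ u) j∈ , Eq.sym (strictlyInverseʳ j))
        , (λ {j} (m , u≤m , j≈κᵈm) → proj₂ (Above-≐ u)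
            (≤-respʳ-≈ (Eq.trans (Eq.sym (strictlyInverseˡ m)) (κ-cong {κᵈ m} {j} (Eq.sym j≈κᵈm))) u≤m))
    ; isIso    = toPair-isOrderIsomorphism
    ; fromPair = fromPair
    ; isJoin   = isJoin
    ; isMeet   = isMeet
    ; leftInv  = fromPair-toPair
    ; rightInv = toPair-fromPair
    }
    where
    open Poset L
    open IsWellSeparatedκLattice K
    open Inverse bijections using (strictlyInverseˡ; strictlyInverseʳ)
    open ConceptLattice (κ-basis isκLattice separated) isComplete
           (Represents.⟶-iff (jiSystem-represents isκLattice))

  -- The system on the irreducibles has fixed universe levels; lifting it reaches every larger
  -- choice of levels.
  wellSeparated⇒≅Pairs : ∀ s e r {L : Poset c ℓ₁ ℓ₂} → IsWellSeparatedκLattice L →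
    Σ[ F ∈ System (s ⊔ suc (c ⊔ ℓ₁ ⊔ ℓ₂)) (e ⊔ ℓ₁) (r ⊔ ℓ₂) ]
      IsTwoAcyclicFactorizationSystem F × L ≅ Pairs (System._⟶_ F)
  wellSeparated⇒≅Pairs s e r K =
    liftSystem s e r (jiSystem isκLattice) , basis⇒twoAcyclic B R , toPair , toPair-isOrderIsomorphism
    where
    open IsWellSeparatedκLattice K
    B = liftBasis {F = jiSystem isκLattice} s e r (κ-basis isκLattice separated)
    R = liftRepresents {F = jiSystem isκLattice} s e r (jiSystem-represents isκLattice)
    open ConceptLattice B isComplete (Represents.⟶-iff R)

  -- From an isomorphism with a lattice of pairs to a basis.

  module FromPairs {L : Poset c ℓ₁ ℓ₂} {F : System s e r} (A : IsTwoAcyclicFactorizationSystem F)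
                   (iso : L ≅ Pairs (System._⟶_ F)) where

    open Poset L renaming (refl to ≤-refl; trans to ≤-trans)
    open System F renaming (Carrier to S; _≈_ to _≈ˢ_)
    open IsTwoAcyclicFactorizationSystem A
    open IsFactorizationSystem isFactorizationSystem using (fact-↠; fact-↪; mult)
      renaming (reflexive to ⟶-reflexive)
    open IsTwoAcyclic isTwoAcyclic
    open MaximalOrthogonalPair
    open IsOrderIsomorphism (proj₂ iso) using (mono; cancel; surjective)
    private
      module S = Setoid setoid

      f : Carrier → MaximalOrthogonalPair _⟶_
      f = proj₁ iso

    -- The least pair whose first component contains `X`, and the greatest pair whose second
    -- component contains `Y`.
    generated cogenerated : Pred S s → MaximalOrthogonalPair _⟶_
    generated X = record
      { fst   = leftPerp _⟶_ (rightPerp _⟶_ X)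
      ; snd   = rightPerp _⟶_ X
      ; snd-≐ = (λ y∈ x∈ → x∈ y∈) , (λ h x∈ → h λ y∈ → y∈ x∈)
      ; fst-≐ = id , id
      }
    cogenerated Y = record
      { fst   = leftPerp _⟶_ Y
      ; snd   = rightPerp _⟶_ (leftPerp _⟶_ Y)
      ; snd-≐ = id , id
      ; fst-≐ = (λ x∈ y∈ → y∈ x∈) , (λ h y∈ → h λ x∈ → x∈ y∈)
      }

    f⁻¹ : MaximalOrthogonalPair _⟶_ → Carrier
    f⁻¹ P = proj₁ (surjective P)

    fst-f⁻¹ : ∀ P → fst (f (f⁻¹ P)) ≐ fst P
    fst-f⁻¹ P = proj₁ (proj₂ (surjective P) Eq.refl)

    -- The singletons use `≡` to stay at level `s`. Compatibility with the setoid equality is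
    -- recovered in `basis`, because `↠` and `↪` respect it.
    J M : S → Carrier
    J x = f⁻¹ (generated (x ≡_))
    M x = f⁻¹ (cogenerated (x ≡_))

    -- One half of the universal property of the least pair containing `x`, carried to `L`. This
    -- lemma and the next three turn comparisons with `J` and `M` into membership in the components
    -- of `f u`.
    J≤⇒∈ : ∀ {x u} → J x ≤ u → x ∈ fst (f u)
    J≤⇒∈ {x} Jx≤u = mono Jx≤u (proj₂ (fst-f⁻¹ (generated (x ≡_))) λ y∈ → y∈ refl)

    ∈⇒J≤ : ∀ {x u} → x ∈ fst (f u) → J x ≤ u
    ∈⇒J≤ {x} {u} x∈ = cancel λ z∈ → proj₂ (fst-≐ (f u)) λ y∈ →
      proj₁ (fst-f⁻¹ (generated (x ≡_))) z∈ λ { refl → proj₁ (fst-≐ (f u)) x∈ y∈ }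

    ≤M⇒∈ : ∀ {x u} → u ≤ M x → x ∈ snd (f u)
    ≤M⇒∈ {x} {u} u≤Mx = proj₂ (snd-≐ (f u)) λ z∈ → proj₁ (fst-f⁻¹ (cogenerated (x ≡_))) (mono u≤Mx z∈) refl

    ∈⇒≤M : ∀ {x u} → x ∈ snd (f u) → u ≤ M x
    ∈⇒≤M {x} {u} x∈ = cancel λ z∈ → proj₂ (fst-f⁻¹ (cogenerated (x ≡_))) λ { refl → proj₁ (fst-≐ (f u)) z∈ x∈ }

    ≤⇒¬⟶ : ∀ {x y} → J x ≤ M y → ¬ x ⟶ y
    ≤⇒¬⟶ {_} {y} Jx≤My = proj₁ (fst-f⁻¹ (cogenerated (y ≡_))) (J≤⇒∈ Jx≤My) refl

    ¬⟶⇒≤ : ∀ {x y} → ¬ x ⟶ y → J x ≤ M y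
    ¬⟶⇒≤ {_} {y} n = ∈⇒J≤ (proj₂ (fst-f⁻¹ (cogenerated (y ≡_))) λ { refl → n })

    J-dense : ∀ {u v} → (∀ x → J x ≤ u → J x ≤ v) → u ≤ v
    J-dense h = cancel λ x∈ → J≤⇒∈ (h _ (∈⇒J≤ x∈))

    M-dense : ∀ {u v} → (∀ x → v ≤ M x → u ≤ M x) → u ≤ v
    M-dense {u} {v} h = cancel λ x∈ → proj₂ (fst-≐ (f v)) λ y∈ →
      proj₁ (fst-≐ (f u)) x∈ (≤M⇒∈ (h _ (∈⇒≤M y∈)))

    represents : Represents L F J M
    represents = record
      { ⟶-iff = (λ x⟶y Jx≤My → ≤⇒¬⟶ Jx≤My x⟶y) , λ n → dne (n ∘ ¬⟶⇒≤)
      ; ↠-iff = (λ x↠y → M-dense λ z Jx≤Mz → ¬⟶⇒≤ (≤⇒¬⟶ Jx≤Mz ∘ proj₂ fact-↠ x↠y z))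
              , (λ Jy≤Jx → proj₁ fact-↠ λ z y⟶z → dne λ n →
                  ≤⇒¬⟶ (≤-trans Jy≤Jx (¬⟶⇒≤ n)) y⟶z)
      ; ↪-iff = (λ x↪y → J-dense λ z Jz≤My → ¬⟶⇒≤ (≤⇒¬⟶ Jz≤My ∘ proj₂ fact-↪ x↪y z))
              , (λ My≤Mx → proj₁ fact-↪ λ z z⟶x → dne λ n →
                  ≤⇒¬⟶ (≤-trans (¬⟶⇒≤ n) My≤Mx) z⟶x)
      }

    open Represents represents

    -- Under `represents`, the order condition becomes injectivity, `mult` becomes factorization,
    -- the brick condition becomes `brick`, and reflexivity of `⟶` becomes `irreflexive`.
    basis : IsBasis L setoid J M
    basis = record
      { J-cong      = λ x≈y → antisym (J-anti (S.sym x≈y)) (J-anti x≈y)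
      ; M-cong      = λ x≈y → antisym (M-anti (S.sym x≈y)) (M-anti x≈y)
      ; J-injective = λ Jx≈Jy → order-↠ (proj₂ ↠-iff (reflexive (Eq.sym Jx≈Jy)))
                                        (proj₂ ↠-iff (reflexive Jx≈Jy))
      ; M-injective = λ Mx≈My → order-↪ (proj₂ ↪-iff (reflexive (Eq.sym Mx≈My)))
                                        (proj₂ ↪-iff (reflexive Mx≈My))
      ; J-dense     = J-dense
      ; M-dense     = M-dense
      ; irreflexive = λ x Jx≤Mx → ≤⇒¬⟶ Jx≤Mx ⟶-reflexive
      ; factor      = λ n → let y , x↠y , y↪z = proj₂ mult (proj₂ ⟶-iff n) in
                        y , proj₁ ↠-iff x↠y , proj₁ ↪-iff y↪z
      ; brick       = λ Jy≤Jx Mx≤My → brick (proj₂ ↠-iff Jy≤Jx) (proj₂ ↪-iff Mx≤My)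
      }
      where
      J-anti : ∀ {x y} → x ≈ˢ y → J y ≤ J x
      J-anti x≈y = proj₁ ↠-iff (proj₁ ↠-resp-≈ x≈y (proj₂ ↠-iff ≤-refl))
      M-anti : ∀ {x y} → x ≈ˢ y → M y ≤ M x
      M-anti x≈y = proj₁ ↪-iff (proj₁ ↪-resp-≈ x≈y (proj₂ ↪-iff ≤-refl))

    -- The pair cogenerated by `Y` corresponds to the meet of the `M y`. Such meets suffice for
    -- completeness, since `M` is meet-dense.
    meetOfM : (Y : Pred S p) → ∃[ u ] (∀ {y} → y ∈ Y → u ≤ M y) ×
                                      (∀ {v} → (∀ {y} → y ∈ Y → v ≤ M y) → v ≤ u)
    meetOfM Y =
        f⁻¹ P
      , (λ y∈ → J-dense λ x Jx≤ → ¬⟶⇒≤ (proj₁ (fst-f⁻¹ P) (J≤⇒∈ Jx≤) (proj₂ (resize-≐ Y) y∈)))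
      , (λ v-lb → J-dense λ x Jx≤v → ∈⇒J≤ (proj₂ (fst-f⁻¹ P) λ y∈ →
          ≤⇒¬⟶ (≤-trans Jx≤v (v-lb (proj₁ (resize-≐ Y) y∈)))))
      where P = cogenerated (resize _ Y)

    complete : IsCompleteLattice L
    complete X =
      -- The join of `X` is the meet of the `M y` above all of `X`; the meet of `X` is the meet of
      -- the `M y` above some member of `X`.
      let u , u-lb , u-greatest = meetOfM (λ y → ∀ {x} → x ∈ X → x ≤ M y)
          v , v-lb , v-greatest = meetOfM (λ y → ∃[ x ] x ∈ X × x ≤ M y)
      in ( u , (λ x∈ → u-greatest λ y∈ → y∈ x∈)
             , (λ w-ub → M-dense λ y w≤My → u-lb λ x∈ → ≤-trans (w-ub x∈) w≤My))
       , ( v , (λ {x} x∈ → M-dense λ y x≤My → v-lb (x , x∈ , x≤My))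
             , (λ w-lb → v-greatest λ (x , x∈ , x≤My) → ≤-trans (w-lb x∈) x≤My))

    wellSeparated : IsWellSeparatedκLattice L
    wellSeparated = basis⇒wellSeparated basis complete

    -- Uniqueness of the system.

    module _ (K : IsκLattice L) where

      open IsκLattice K using (κ; κ-greatest)
      open BasisProperties basis
      open IsBasis basis using (J-cong; M-cong; J-injective)

      toJi : S → Setoid.Carrier (Jiᶜ L)
      toJi x = J x , J-isCompletelyJoinIrreducible x

      -- Both sides are greatest in the same set, the one defined by the star that `K` supplies for
      -- `J x`.
      κ∘J≈M : ∀ x → proj₁ (κ (toJi x)) ≈ M x
      κ∘J≈M x = let _ , star , κ-max = κ-greatest (toJi x) in
        IsGreatest-unique L κ-max (Isκ⇒isGreatest L (isκ x) star)

      -- The bijection is common to the three relations, so only preservation and reflection remain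
      -- for each. Surjectivity holds because every completely join-irreducible element is some
      -- `J x`.
      toJi-isOrderIsomorphism : ∀ {t t′} {_∼_ : Rel S t} {_∼′_ : Rel (Setoid.Carrier (Jiᶜ L)) t′} →
        (∀ {x y} → x ∼ y → toJi x ∼′ toJi y) → (∀ {x y} → toJi x ∼′ toJi y → x ∼ y) →
        IsOrderIsomorphism _≈ˢ_ (Setoid._≈_ (Jiᶜ L)) _∼_ _∼′_ toJi
      toJi-isOrderIsomorphism mono cancel = record
        { isOrderMonomorphism = record
          { isOrderHomomorphism = record { cong = J-cong ; mono = mono }
          ; injective = J-injective
          ; cancel    = cancel
          }
        ; surjective = λ (_ , cji) → let x , j≈Jx = completelyJoinIrreducible⇒J cji in
            x , λ y≈x → Eq.trans (J-cong y≈x) (Eq.sym j≈Jx)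
        }

      ≅ˢ-jiSystem : F ≅ˢ jiSystem K
      ≅ˢ-jiSystem = record
        { to    = toJi
        ; ⟶-iso = toJi-isOrderIsomorphism
            (λ {_} {y} x⟶y Jx≤ → proj₁ ⟶-iff x⟶y (≤-respʳ-≈ (κ∘J≈M y) Jx≤))
            (λ {_} {y} n → proj₂ ⟶-iff λ Jx≤My → n (≤-respʳ-≈ (Eq.sym (κ∘J≈M y)) Jx≤My))
        ; ↠-iso = toJi-isOrderIsomorphism (proj₁ ↠-iff) (proj₂ ↠-iff)
        ; ↪-iso = toJi-isOrderIsomorphism
            (λ {x} {y} x↪y → ≤-respˡ-≈ (Eq.sym (κ∘J≈M y))
              (≤-respʳ-≈ (Eq.sym (κ∘J≈M x)) (proj₁ ↪-iff x↪y)))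
            (λ {x} {y} h → proj₂ ↪-iff (≤-respˡ-≈ (κ∘J≈M y) (≤-respʳ-≈ (κ∘J≈M x) h)))
        }

theorem1p4 : (∀ {a} → ExcludedMiddle a) →
    ∀ {c ℓ₁ ℓ₂ s e r} (L : Poset c ℓ₁ ℓ₂) →
    (IsWellSeparatedκLattice L ⇔
    (Σ[ F ∈ System (s ⊔ suc (c ⊔ ℓ₁ ⊔ ℓ₂)) (e ⊔ ℓ₁) (r ⊔ ℓ₂) ]
    IsTwoAcyclicFactorizationSystem F × L ≅ Pairs (System._⟶_ F)))
    ×
    ((K : IsWellSeparatedκLattice L) →
    ((F : System s e r) → IsTwoAcyclicFactorizationSystem F →
    L ≅ Pairs (System._⟶_ F) →
    F ≅ˢ jiSystem (IsWellSeparatedκLattice.isκLattice K))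
    × CanonicalIsomorphism (IsWellSeparatedκLattice.isκLattice K))
theorem1p4 em {s = s} {e} {r} L =
    mk⇔ (wellSeparated⇒≅Pairs s e r) (λ (_ , A , iso) → FromPairs.wellSeparated A iso)
  , λ K → (λ _ A iso → FromPairs.≅ˢ-jiSystem A iso (IsWellSeparatedκLattice.isκLattice K))
        , wellSeparated⇒canonicalIsomorphism K
  where open Classical em
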